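{- Let $\mathcal{C}$ be a nondegenerate $[n,k,d]_{q^m/q}$ rank-metric code and let $\mathcal{C}^{\mathrm{H}}$ be any Hamming-metric code associated with $\mathcal{C}$. Then $\mathcal{C}$ is (rank-)minimal if and only if $\mathcal{C}^{\mathrm{H}}$ is Hamming-minimal.
   Context: Let $q$ be a prime power and $n,m,k$ positive integers. For $v\in\mathbb{F}_{q^m}^n$ and an ordered basis $\Gamma=(\gamma_1,\dots,\gamma_m)$ of $\mathbb{F}_{q^m}$ over $\mathbb{F}_q$, let $\Gamma(v)\in\mathbb{F}_q^{n\times m}$ be the matrix with $v_i=\sum_{j}\Gamma(v)_{ij}\gamma_j$. The rank support $\sigma^{\mathrm{rk}}(v)\subseteq\mathbb{F}_q^n$ is the column space of $\Gamma(v)$ (independent of $\Gamma$), and $\mathrm{rk}(v)=\dim_{\mathbb{F}_q}\sigma^{\mathrm{rk}}(v)$. An $[n,k,d]_{q^m/q}$ code is a $k$-dimensional $\mathbb{F}_{q^m}$-subspace $\mathcal{C}\subseteq\mathbb{F}_{q^m}^n$ whose nonzero codewords have minimum rank $d$; it is nondegenerate if $\sum_{v\in\mathcal{C}}\sigma^{\mathrm{rk}}(v)=\mathbb{F}_q^n$. It is (rank-)minimal if for all $v,v'\in\mathcal{C}$, $\sigma^{\mathrm{rk}}(v')\subseteq\sigma^{\mathrm{rk}}(v)$ implies $v'=\alpha v$ for some $\alpha\in\mathbb{F}_{q^m}$. A linear code $\mathcal{D}\subseteq\mathbb{F}_{q^m}^N$ is Hamming-minimal if, for every $c\in\mathcal{D}$,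 every nonzero $c'\in\mathcal{D}$ with $\{i:c'_i\neq0\}\subseteq\{i:c_i\neq0\}$ is an $\mathbb{F}_{q^m}$-multiple of $c$. Associated Hamming-metric code. Let $\mathcal{C}$ be a nondegenerate $[n,k]_{q^m/q}$ code, let $G\in\mathbb{F}_{q^m}^{k\times n}$ be a generator matrix and let $\mathcal{U}\subseteq\mathbb{F}_{q^m}^k$ be the $\mathbb{F}_q$-span of the columns of $G$. For a point $P=\langle w\rangle_{\mathbb{F}_{q^m}}$ of $\mathrm{PG}(k-1,q^m)$ set $\mathrm{wt}_{\mathcal{U}}(P)=\dim_{\mathbb{F}_q}(\mathcal{U}\cap\langle w\rangle_{\mathbb{F}_{q^m}})$ and $\mathrm{m}_{\mathcal{U}}(P)=\frac{q^{\mathrm{wt}_{\mathcal{U}}(P)}-1}{q-1}$. One has $\sum_P \mathrm{m}_{\mathcal{U}}(P)=\frac{q^n-1}{q-1}$. Let $G_{\mathrm{Ext}}$ be a $k\times\frac{q^n-1}{q-1}$ matrix over $\mathbb{F}_{q^m}$ whose columns are, in some order, nonzero representative vectors of the points $P$, each point $P$ being represented by exactly $\mathrm{m}_{\mathcal{U}}(P)$ columns. A Hamming-metric code associated with $\mathcal{C}$, denoted $\mathcal{C}^{\mathrm{H}}$, is any code of length $\frac{q^n-1}{q-1}$ over $\mathbb{F}_{q^m}$ that is monomially equivalent to (i.e. the image under an $\mathbb{F}_{q^m}$-linear Hamming isometry of) the row space of $G_{\mathrm{Ext}}$; up to monomial equivalence it does not depend on the choices made. -}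

module Defs where

open import Algebra.Bundles using (Ring; CommutativeRing)
open import Algebra.Module.Bundles using (LeftModule)
import Algebra.Module.Construct.TensorUnit as TensorUnit
open import Algebra.Module.Morphism.Structures using (module LeftModuleMorphisms)
open import Algebra.Morphism.Structures using (module RingMorphisms)
import Algebra.Properties.CommutativeMonoid.Sum as Sum
open import Data.Fin.Base using (Fin; zero; suc)
import Data.Fin.Properties as Fin
open import Data.Nat.Base using (ℕ; zero; suc; NonZero; _^_; _∸_; _/_; _≤_; _<_)
open import Data.Nat.Primality using (Prime)
open import Data.Product.Base using (_×_; _,_; proj₁; ∃; ∃₂; ∃-syntax; Σ-syntax)
open import Data.Vec.Base using (count; allFin)
open import Data.Vec.Functional using (Vector; transpose)
import Data.Vec.Functional.Relation.Binary.Equality.Setoid as VecEq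
open import Function.Base using (_∘_)
open import Function.Bundles using (Inverse)
open import Function.Properties.Inverse using (Inverse⇒Injection)
open import Level using (Level; _⊔_) renaming (suc to ℓsuc)
open import Relation.Binary.Definitions renaming (Decidable to Decidable₂)
open import Relation.Binary.PropositionalEquality.Core using (_≡_; _≢_; refl; cong)
import Relation.Binary.PropositionalEquality.Properties as ≡
open import Relation.Nullary.Decidable using (Dec; map′; ¬?; via-injection)
open import Relation.Nullary.Negation using (contradiction)
open import Relation.Unary using (Pred; Decidable; U; _∈_; _⊆_; _∩_; _≐_)

PrimePower : ℕ → Set
PrimePower q = ∃₂ λ p e → Prime p × 0 < e × q ≡ p ^ e

------------------------------------------------------------------------
-- Finite fields

private
  pred-nonZero : ∀ {q} {i j : Fin q} → i ≢ j → NonZero (q ∸ 1)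
  pred-nonZero {suc zero}    {zero} {zero} i≢j = contradiction refl i≢j
  pred-nonZero {suc (suc q)}                   _   = _

record FiniteField (c ℓ : Level) (q : ℕ) : Set (ℓsuc (c ⊔ ℓ)) where
  field
    commutativeRing : CommutativeRing c ℓ

  open CommutativeRing commutativeRing public

  field
    1≉0         : 1# ≉ 0#
    inverse     : ∀ x → x ≉ 0# → ∃[ y ] x * y ≈ 1#
    enumeration : Inverse setoid (≡.setoid (Fin q))

  open Inverse enumeration using (to; from; strictlyInverseʳ)

  infix 4 _≟_
  _≟_ : Decidable₂ _≈_
  _≟_ = via-injection (Inverse⇒Injection enumeration) Fin._≟_

  any? : ∀ {p} {P : Pred Carrier p} → (∀ {x y} → x ≈ y → P x → P y) →
         Decidable P → Dec (∃ P)
  any? resp P? = map′ (λ (i , p) → from i , p)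
                      (λ (x , p) → to x , resp (sym (strictlyInverseʳ x)) p)
                      (Fin.any? (P? ∘ from))

  instance
    q∸1≢0 : NonZero (q ∸ 1)
    q∸1≢0 = pred-nonZero λ eq → 1≉0
      (trans (sym (strictlyInverseʳ 1#))
             (trans (reflexive (cong from eq)) (strictlyInverseʳ 0#)))

  -- The number of points of PG(n-1,q).
  #points : ℕ → ℕ
  #points n = (q ^ n ∸ 1) / (q ∸ 1)

------------------------------------------------------------------------
-- Constructions of modules

power : ∀ {r ℓr a ℓa} {R : Ring r ℓr} → LeftModule R a ℓa → ℕ → LeftModule R a ℓa
power V n = record
  { Carrierᴹ = Vector Carrierᴹ n
  ; _≈ᴹ_     = VecEq._≋_ ≈ᴹ-setoid
  ; _+ᴹ_     = λ v w i → v i +ᴹ w i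
  ; _*ₗ_     = λ a v i → a *ₗ v i
  ; 0ᴹ       = λ _ → 0ᴹ
  ; -ᴹ_      = λ v i → -ᴹ v i
  ; isLeftModule = record
    { isLeftSemimodule = record
      { +ᴹ-isCommutativeMonoid = record
        { isMonoid = record
          { isSemigroup = record
            { isMagma = record
              { isEquivalence = VecEq.≋-isEquivalence ≈ᴹ-setoid n
              ; ∙-cong        = λ p q i → +ᴹ-cong (p i) (q i)
              }
            ; assoc = λ u v w i → +ᴹ-assoc (u i) (v i) (w i)
            }
          ; identity = (λ v i → +ᴹ-identityˡ (v i)) , (λ v i → +ᴹ-identityʳ (v i))
          }
        ; comm = λ v w i → +ᴹ-comm (v i) (w i)
        }
      ; isPreleftSemimodule = record
        { *ₗ-cong      = λ p q i → *ₗ-cong p (q i)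
        ; *ₗ-zeroˡ     = λ v i → *ₗ-zeroˡ (v i)
        ; *ₗ-distribʳ  = λ v a b i → *ₗ-distribʳ (v i) a b
        ; *ₗ-identityˡ = λ v i → *ₗ-identityˡ (v i)
        ; *ₗ-assoc     = λ a b v i → *ₗ-assoc a b (v i)
        ; *ₗ-zeroʳ     = λ a i → *ₗ-zeroʳ a
        ; *ₗ-distribˡ  = λ a v w i → *ₗ-distribˡ a (v i) (w i)
        }
      }
    ; -ᴹ‿cong    = λ p i → -ᴹ‿cong (p i)
    ; -ᴹ‿inverse = (λ v i → -ᴹ‿inverseˡ (v i)) , (λ v i → -ᴹ‿inverseʳ (v i))
    }
  }
  where open LeftModule V

module _ {r ℓr s ℓs} {R : Ring r ℓr} {S : Ring s ℓs} where
  private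
    module R = Ring R
    module S = Ring S
  open RingMorphisms R.rawRing S.rawRing using (IsRingHomomorphism)

  restrictScalars : ∀ {a ℓa} {ι : R.Carrier → S.Carrier} → IsRingHomomorphism ι →
                    LeftModule S a ℓa → LeftModule R a ℓa
  restrictScalars {ι = ι} ι-hom V = record
    { Carrierᴹ = Carrierᴹ
    ; _≈ᴹ_     = _≈ᴹ_
    ; _+ᴹ_     = _+ᴹ_
    ; _*ₗ_     = λ a v → ι a *ₗ v
    ; 0ᴹ       = 0ᴹ
    ; -ᴹ_      = -ᴹ_
    ; isLeftModule = record
      { isLeftSemimodule = record
        { +ᴹ-isCommutativeMonoid = +ᴹ-isCommutativeMonoid
        ; isPreleftSemimodule = record
          { *ₗ-cong      = λ p q → *ₗ-cong (⟦⟧-cong p) q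
          ; *ₗ-zeroˡ     = λ v → ≈ᴹ-trans (*ₗ-cong 0#-homo ≈ᴹ-refl) (*ₗ-zeroˡ v)
          ; *ₗ-distribʳ  = λ v a b →
              ≈ᴹ-trans (*ₗ-cong (+-homo a b) ≈ᴹ-refl) (*ₗ-distribʳ v (ι a) (ι b))
          ; *ₗ-identityˡ = λ v → ≈ᴹ-trans (*ₗ-cong 1#-homo ≈ᴹ-refl) (*ₗ-identityˡ v)
          ; *ₗ-assoc     = λ a b v →
              ≈ᴹ-trans (*ₗ-cong (*-homo a b) ≈ᴹ-refl) (*ₗ-assoc (ι a) (ι b) v)
          ; *ₗ-zeroʳ     = λ a → *ₗ-zeroʳ (ι a)
          ; *ₗ-distribˡ  = λ a v w → *ₗ-distribˡ (ι a) v w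
          }
        }
      ; -ᴹ‿cong    = -ᴹ‿cong
      ; -ᴹ‿inverse = -ᴹ‿inverse
      }
    }
    where
    open LeftModule V
    open RingMorphisms.IsRingHomomorphism ι-hom

------------------------------------------------------------------------
-- Linear algebra

module LinearAlgebra {r ℓr a ℓa} {R : Ring r ℓr} (V : LeftModule R a ℓa) where
  private module R = Ring R
  open LeftModule V
  open Sum +ᴹ-commutativeMonoid public using (sum)

  lin : ∀ {d} → Vector R.Carrier d → Vector Carrierᴹ d → Carrierᴹ
  lin x b = sum λ i → x i *ₗ b i

  Span : ∀ {d} → Vector Carrierᴹ d → Pred Carrierᴹ (r ⊔ ℓa)
  Span b v = ∃[ x ] v ≈ᴹ lin x b

  Line : Carrierᴹ → Pred Carrierᴹ (r ⊔ ℓa)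
  Line w v = ∃[ α ] v ≈ᴹ α *ₗ w

  LinearlyIndependent : ∀ {d} → Vector Carrierᴹ d → Set (r ⊔ ℓr ⊔ ℓa)
  LinearlyIndependent b = ∀ x → lin x b ≈ᴹ 0ᴹ → ∀ i → x i R.≈ R.0#

  record IsSubspace {p} (S : Pred Carrierᴹ p) : Set (r ⊔ a ⊔ ℓa ⊔ p) where
    field
      resp : ∀ {v w} → v ≈ᴹ w → v ∈ S → w ∈ S
      0∈   : 0ᴹ ∈ S
      +∈   : ∀ {v w} → v ∈ S → w ∈ S → v +ᴹ w ∈ S
      *∈   : ∀ x {v} → v ∈ S → x *ₗ v ∈ S

  record IsBasis {p d} (S : Pred Carrierᴹ p) (b : Vector Carrierᴹ d)
                 : Set (r ⊔ ℓr ⊔ a ⊔ ℓa ⊔ p) where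
    field
      inside      : ∀ i → b i ∈ S
      independent : LinearlyIndependent b
      spanning    : S ⊆ Span b

  HasDim : ∀ {p} → Pred Carrierᴹ p → ℕ → Set (r ⊔ ℓr ⊔ a ⊔ ℓa ⊔ p)
  HasDim S d = Σ[ b ∈ Vector Carrierᴹ d ] IsBasis S b

------------------------------------------------------------------------
-- Hamming metric over a finite field

module HammingMetric {c ℓ q} (F : FiniteField c ℓ q) where
  open FiniteField F

  Space : ℕ → LeftModule ring c ℓ
  Space = power TensorUnit.leftModule

  module Space n = LeftModule (Space n)
  module LA n = LinearAlgebra (Space n)

  Line? : ∀ {n} w → Decidable (LA.Line n w)
  Line? {n} w v = any?
    (λ α≈β p → ≈ᴹ-trans p (*ₗ-cong α≈β ≈ᴹ-refl))
    (λ α → Fin.all? λ i → v i ≟ α * w i)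
    where open LeftModule (Space n) using (≈ᴹ-trans; ≈ᴹ-refl; *ₗ-cong)

  supp : ∀ {n} → Vector Carrier n → Pred (Fin n) ℓ
  supp v i = v i ≉ 0#

  distance : ∀ {n} → Vector Carrier n → Vector Carrier n → ℕ
  distance {n} v w = count (λ i → ¬? (v i ≟ w i)) (allFin n)

  -- Preservation of distance makes φ injective, hence bijective by finiteness.
  record IsLinearIsometry {n} (φ : Vector Carrier n → Vector Carrier n) : Set (c ⊔ ℓ) where
    open LeftModuleMorphisms (Space.rawLeftModule n) (Space.rawLeftModule n)
    field
      linear   : IsLeftModuleHomomorphism φ
      isometry : ∀ v w → distance (φ v) (φ w) ≡ distance v w

  HammingMinimal : ∀ {p n} → Pred (Vector Carrier n) p → Set (c ⊔ ℓ ⊔ p)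
  HammingMinimal {n = n} D = ∀ v v′ → v ∈ D → v′ ∈ D → v′ ≉ᴹ 0ᴹ →
    supp v′ ⊆ supp v → v′ ∈ LA.Line n v
    where open LeftModule (Space n)

------------------------------------------------------------------------
-- Rank metric over an extension of finite fields

module RankMetric
  {cK ℓK cL ℓL : Level} {q m : ℕ}
  (K : FiniteField cK ℓK q) (L : FiniteField cL ℓL (q ^ m))
  (ι : FiniteField.Carrier K → FiniteField.Carrier L)
  (ι-hom : RingMorphisms.IsRingHomomorphism (FiniteField.rawRing K) (FiniteField.rawRing L) ι)
  where

  private
    module K = FiniteField K
    module L = FiniteField L

  open HammingMetric L using (IsLinearIsometry; Line?)

  Kⁿ : ℕ → LeftModule K.ring cK ℓK
  Kⁿ = HammingMetric.Space K

  Lⁿ : ℕ → LeftModule L.ring cL ℓL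
  Lⁿ = HammingMetric.Space L

  L/K : LeftModule K.ring cL ℓL
  L/K = restrictScalars {S = L.ring} ι-hom TensorUnit.leftModule

  Lⁿ/K : ℕ → LeftModule K.ring cL ℓL
  Lⁿ/K n = restrictScalars ι-hom (Lⁿ n)

  module Kⁿ n = LinearAlgebra (Kⁿ n)
  module Lⁿ n = LinearAlgebra (Lⁿ n)
  module L/K = LinearAlgebra L/K
  module Lⁿ/K n = LinearAlgebra (Lⁿ/K n)

  module _ {Γ : Vector L.Carrier m} (Γ-basis : L/K.IsBasis U Γ) where

    coordinates : ∀ {n} → Vector L.Carrier n → Vector (Vector K.Carrier m) n
    coordinates v i = proj₁ (L/K.IsBasis.spanning Γ-basis {v i} _)

    rankSupport : ∀ {n} → Vector L.Carrier n → Pred (Vector K.Carrier n) (cK ⊔ ℓK)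
    rankSupport {n} v = Kⁿ.Span n (transpose (coordinates v))

    HasRank : ∀ {n} → Vector L.Carrier n → ℕ → Set (cK ⊔ ℓK)
    HasRank {n} v r = Kⁿ.HasDim n (rankSupport v) r

    record IsRankMetricCode {p} (n k d : ℕ) (C : Pred (Vector L.Carrier n) p)
                            : Set (cK ⊔ ℓK ⊔ cL ⊔ ℓL ⊔ p) where
      open LeftModule (Lⁿ n) using (_≉ᴹ_; 0ᴹ)
      field
        subspace  : Lⁿ.IsSubspace n C
        dimension : Lⁿ.HasDim n C k
        attained  : ∃[ v ] v ∈ C × v ≉ᴹ 0ᴹ × HasRank v d
        minimum   : ∀ v r → v ∈ C → v ≉ᴹ 0ᴹ → HasRank v r → d ≤ r

    -- The sum of the rank supports of all codewords, i.e. the set of all finite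
    -- sums of vectors taken from them, is the whole space.
    Nondegenerate : ∀ {p n} → Pred (Vector L.Carrier n) p → Set (cK ⊔ ℓK ⊔ cL ⊔ p)
    Nondegenerate {n = n} C = ∀ x → ∃[ s ]
      Σ[ v ∈ Vector (Vector L.Carrier n) s ] Σ[ y ∈ Vector (Vector K.Carrier n) s ]
        (∀ i → v i ∈ C) × (∀ i → y i ∈ rankSupport (v i)) × x ≈ᴹ Kⁿ.sum n y
      where open LeftModule (Kⁿ n) using (_≈ᴹ_)

    RankMinimal : ∀ {p n} → Pred (Vector L.Carrier n) p → Set (cK ⊔ ℓK ⊔ cL ⊔ ℓL ⊔ p)
    RankMinimal {n = n} C = ∀ v v′ → v ∈ C → v′ ∈ C →
      rankSupport v′ ⊆ rankSupport v → v′ ∈ Lⁿ.Line n v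

  columnSpan : ∀ {k n} → Vector (Vector L.Carrier n) k → Pred (Vector L.Carrier k) (cK ⊔ ℓL)
  columnSpan {k} G = Lⁿ/K.Span k (transpose G)

  -- A point of PG(k-1,q^m) is given by a nonzero vector w spanning it.
  HasMultiplicity : ∀ {p k} → Pred (Vector L.Carrier k) p → Vector L.Carrier k →
                    ℕ → Set (cK ⊔ ℓK ⊔ cL ⊔ ℓL ⊔ p)
  HasMultiplicity {k = k} W w μ =
    ∃[ t ] Lⁿ/K.HasDim k (W ∩ Lⁿ.Line k w) t × μ ≡ K.#points t

  record IsExtendedMatrix {k n} (G : Vector (Vector L.Carrier n) k)
                          (E : Vector (Vector L.Carrier (K.#points n)) k)
                          : Set (cK ⊔ ℓK ⊔ cL ⊔ ℓL) where
    open LeftModule (Lⁿ k) using (_≉ᴹ_; 0ᴹ)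
    -- A column, being nonzero, represents the point ⟨ w ⟩ iff it lies on Line w.
    field
      nonzero      : ∀ j → transpose E j ≉ᴹ 0ᴹ
      multiplicity : ∀ w → w ≉ᴹ 0ᴹ → HasMultiplicity (columnSpan G) w
        (count (λ j → Line? w (transpose E j)) (allFin (K.#points n)))

  record IsAssociatedHammingCode {p p′} {n : ℕ} (k : ℕ) (C : Pred (Vector L.Carrier n) p)
                                 (D : Pred (Vector L.Carrier (K.#points n)) p′)
                                 : Set (cK ⊔ ℓK ⊔ cL ⊔ ℓL ⊔ p ⊔ p′) where
    N : ℕ
    N = K.#points n
    open LeftModule (Lⁿ N) using (_≈ᴹ_)
    field
      G          : Vector (Vector L.Carrier n) k
      generator  : Lⁿ.IsBasis n C G
      E          : Vector (Vector L.Carrier N) k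
      extended   : IsExtendedMatrix G E
      φ          : Vector L.Carrier N → Vector L.Carrier N
      φ-isometry : IsLinearIsometry φ
      image      : D ≐ λ c → ∃[ x ] x ∈ Lⁿ.Span N E × c ≈ᴹ φ x

{-# OPTIONS --safe #-}

-- Codewords of C and of the row space of E are x G and x E for a common x. By duality
-- over K, σ(x′G) ⊆ σ(xG) says that every z ∈ Kⁿ annihilating xG annihilates x′G; since
-- ⟨z , xG⟩ = ⟨x , u⟩ for the vector u = Gz of the column span 𝒰 of G, this means that
-- ⟨x , u⟩ = 0 implies ⟨x′ , u⟩ = 0 for u ∈ 𝒰. The columns of E are, up to scalars,
-- exactly the nonzero elements of 𝒰, so the condition is supp(x′E) ⊆ supp(xE). Finally,
-- v and w have disjoint supports iff d(v , w) = d(v , 0) + d(w , 0), so linear isometries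
-- preserve disjointness and with it inclusion of supports.

module Submission where

open import Defs
import Algebra.Properties.Group as GroupProperties
import Algebra.Properties.Ring as RingProperties
import Algebra.Properties.Semiring.Sum as SemiringSum
open import Algebra.Bundles using (Ring)
open import Algebra.Module.Bundles using (LeftModule)
open import Algebra.Module.Morphism.Structures using (module LeftModuleMorphisms)
open import Algebra.Morphism.Structures using (module RingMorphisms)
open import Data.Fin.Base using (Fin; zero; suc)
import Data.Fin.Properties as Fin
open import Data.Nat.Base as ℕ using (ℕ; zero; suc; NonZero; _^_; _∸_; _/_; _≤_; _<_; z≤n; s≤s)
open import Data.Nat.DivMod using (0/n≡0; m≥n⇒m/n>0)
import Data.Nat.Properties as ℕ
open import Data.Nat.Properties using
  (+-suc; <⇒≢; n≮0; m≤n⇒m≤1+n; ∸-monoˡ-≤; m≤m*n; m^n≢0)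
open import Data.Product.Base using (∃; ∃-syntax; _×_; _,_; proj₁; proj₂)
open import Data.Sum.Base using (_⊎_; inj₁; inj₂; [_,_])
import Data.Sum.Base as Sum
open import Data.Vec.Base using (Vec; []; _∷_; allFin; count)
import Data.Vec.Functional as Vector
open import Data.Vec.Functional using (Vector; transpose)
open import Data.Vec.Membership.Propositional using () renaming (_∈_ to _∈ᵥ_)
open import Data.Vec.Membership.Propositional.Properties using (∈-allFin⁺)
open import Data.Vec.Relation.Unary.Any using (here; there)
open import Function.Base using (_∘_)
open import Function.Bundles using (_⇔_; mk⇔)
open import Level using (Level)
import Relation.Binary.PropositionalEquality.Core as ≡
open ≡ using (_≡_; _≢_)
import Relation.Binary.Reasoning.Setoid as SetoidReasoning
open import Relation.Nullary.Decidable using (Dec; yes; no; ¬?; decidable-stable)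
open import Relation.Nullary.Negation using (¬_; contradiction)
open import Relation.Unary using (Pred; Decidable; U; _∈_; _⊆_; _∪_)

private
  variable
    a p r s : Level
    A : Set a

-- Counting the entries of a vector that satisfy a decidable predicate.

module _ {P : Pred A p} (P? : Decidable P) where

  count>0 : ∀ {n x} {xs : Vec A n} → x ∈ᵥ xs → P x → 0 < count P? xs
  count>0 {xs = y ∷ xs} x∈ px with P? y | x∈
  ... | yes _  | _           = s≤s z≤n
  ... | no ¬py | here ≡.refl = contradiction px ¬py
  ... | no _   | there x∈xs  = count>0 x∈xs px

  count≡0 : (∀ x → ¬ P x) → ∀ {n} (xs : Vec A n) → count P? xs ≡ 0
  count≡0 ¬P []       = ≡.refl
  count≡0 ¬P (x ∷ xs) with P? x
  ... | yes px = contradiction px (¬P x)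
  ... | no _   = count≡0 ¬P xs

  count>0⇒∃ : ∀ {n} {xs : Vec A n} → 0 < count P? xs → ∃ P
  count>0⇒∃ {xs = []}     0<0 = contradiction 0<0 n≮0
  count>0⇒∃ {xs = x ∷ xs} 0<c with P? x
  ... | yes px = x , px
  ... | no _   = count>0⇒∃ {xs = xs} 0<c

module _ {P : Pred A p} {R : Pred A r} {S : Pred A s}
         (P? : Decidable P) (R? : Decidable R) (S? : Decidable S)
         (S⊆P∪R : S ⊆ P ∪ R) where

  count-∪-≤ : ∀ {n} (xs : Vec A n) → count S? xs ≤ count P? xs ℕ.+ count R? xs
  count-∪-≤ []       = z≤n
  count-∪-≤ (x ∷ xs) with ih ← count-∪-≤ xs | P? x | R? x | S? x
  ... | no ¬p | no ¬r | yes s = contradiction (S⊆P∪R s) [ ¬p , ¬r ]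
  ... | no _  | no _  | no _  = ih
  ... | yes _ | no _  | yes _ = s≤s ih
  ... | yes _ | no _  | no _  = m≤n⇒m≤1+n ih
  ... | no _  | yes _ | yes _ rewrite +-suc (count P? xs) (count R? xs) = s≤s ih
  ... | no _  | yes _ | no _  rewrite +-suc (count P? xs) (count R? xs) = m≤n⇒m≤1+n ih
  ... | yes _ | yes _ | yes _ rewrite +-suc (count P? xs) (count R? xs) = s≤s (m≤n⇒m≤1+n ih)
  ... | yes _ | yes _ | no _  rewrite +-suc (count P? xs) (count R? xs) =
    m≤n⇒m≤1+n (m≤n⇒m≤1+n ih)

  -- The entry `x` counts twice on the right and at most once on the left; `count-∪-≤` handles the
  -- entries after it. For Hamming distances this makes the triangle inequality through 0 strict as
  -- soon as two supports meet.
  count-∪-< : ∀ {n x} {xs : Vec A n} → x ∈ᵥ xs → P x → R x →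
              count S? xs < count P? xs ℕ.+ count R? xs
  count-∪-< {xs = y ∷ xs} (here ≡.refl) px rx with ih ← count-∪-≤ xs | P? y | R? y | S? y
  ... | no ¬p | _     | _     = contradiction px ¬p
  ... | _     | no ¬r | _     = contradiction rx ¬r
  ... | yes _ | yes _ | yes _ rewrite +-suc (count P? xs) (count R? xs) = s≤s (s≤s ih)
  ... | yes _ | yes _ | no _  rewrite +-suc (count P? xs) (count R? xs) = s≤s (m≤n⇒m≤1+n ih)
  count-∪-< {xs = y ∷ xs} (there x∈xs) px rx
    with ih ← count-∪-< x∈xs px rx | P? y | R? y | S? y
  ... | no ¬p | no ¬r | yes s = contradiction (S⊆P∪R s) [ ¬p , ¬r ]
  ... | no _  | no _  | no _  = ih
  ... | yes _ | no _  | yes _ = s≤s ih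
  ... | yes _ | no _  | no _  = m≤n⇒m≤1+n ih
  ... | no _  | yes _ | yes _ rewrite +-suc (count P? xs) (count R? xs) = s≤s ih
  ... | no _  | yes _ | no _  rewrite +-suc (count P? xs) (count R? xs) = m≤n⇒m≤1+n ih
  ... | yes _ | yes _ | yes _ rewrite +-suc (count P? xs) (count R? xs) = s≤s (m≤n⇒m≤1+n ih)
  ... | yes _ | yes _ | no _  rewrite +-suc (count P? xs) (count R? xs) =
    m≤n⇒m≤1+n (m≤n⇒m≤1+n ih)

  -- Here `S` is the disjoint union of `P` and `R`, so every entry contributes equally to both
  -- sides.
  count-⊎ : P ⊆ S → R ⊆ S → (∀ {x} → P x → ¬ R x) →
            ∀ {n} (xs : Vec A n) → count S? xs ≡ count P? xs ℕ.+ count R? xs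
  count-⊎ P⊆S R⊆S P∩R []       = ≡.refl
  count-⊎ P⊆S R⊆S P∩R (x ∷ xs) with ih ← count-⊎ P⊆S R⊆S P∩R xs | P? x | R? x | S? x
  ... | yes p | yes r | _     = contradiction r (P∩R p)
  ... | yes p | _     | no ¬s = contradiction (P⊆S p) ¬s
  ... | _     | yes r | no ¬s = contradiction (R⊆S r) ¬s
  ... | no ¬p | no ¬r | yes s = contradiction (S⊆P∪R s) [ ¬p , ¬r ]
  ... | yes _ | no _  | yes _ = ≡.cong suc ih
  ... | no _  | yes _ | yes _ = ≡.trans (≡.cong suc ih) (≡.sym (+-suc _ _))
  ... | no _  | no _  | no _  = ih


-- The numerator is at least the divisor because `q` is at most `q ^ suc t`. Thus a point of
-- positive weight is represented by at least one column.
#points>0 : ∀ q t .{{_ : NonZero (q ∸ 1)}} → 0 < (q ^ suc t ∸ 1) / (q ∸ 1)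
#points>0 (suc q) t = m≥n⇒m/n>0 (∸-monoˡ-≤ 1 (m≤m*n (suc q) (suc q ^ t)))
  where instance _ = m^n≢0 (suc q) t

module _ {r ℓr m ℓm} {R : Ring r ℓr} (V : LeftModule R m ℓm) where
  open LeftModule V
  open LinearAlgebra V

  lin∈ : ∀ {p} {S : Pred Carrierᴹ p} → IsSubspace S →
         ∀ {d} {b : Vector Carrierᴹ d} → (∀ i → b i ∈ S) → ∀ x → lin x b ∈ S
  lin∈ S-sub {zero}  b∈ x = IsSubspace.0∈ S-sub
  lin∈ S-sub {suc d} b∈ x = +∈ (*∈ (x zero) (b∈ zero)) (lin∈ S-sub (b∈ ∘ suc) (x ∘ suc))
    where open IsSubspace S-sub

-- Dot products, linear combinations and double annihilators over a finite field.

module DotProduct {c ℓ q} (F : FiniteField c ℓ q) where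
  open FiniteField F hiding (zero)
  open HammingMetric F using (Space; module LA)
  open RingProperties ring using (-‿distribˡ-*)
  open GroupProperties +-group using (x∙y⁻¹≈ε⇒x≈y; x≈y⇒x∙y⁻¹≈ε)
  open SemiringSum semiring
  open SetoidReasoning setoid

  infixl 7 _·_
  _·_ : ∀ {n} → Vector Carrier n → Vector Carrier n → Carrier
  u · v = sum λ i → u i * v i

  module _ {n : ℕ} where
    open LeftModule (Space n) public using (_≈ᴹ_; 0ᴹ; _+ᴹ_; _*ₗ_)

  δ : ∀ {n} → Fin n → Vector Carrier n
  δ zero    zero    = 1#
  δ zero    (suc j) = 0#
  δ (suc i) zero    = 0#
  δ (suc i) (suc j) = δ i j

  δ-diagonal : ∀ {n} (i : Fin n) → δ i i ≈ 1#
  δ-diagonal zero    = refl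
  δ-diagonal (suc i) = δ-diagonal i

  δ-offDiagonal : ∀ {n} (i j : Fin n) → j ≢ i → δ i j ≈ 0#
  δ-offDiagonal zero    zero    j≢i = contradiction ≡.refl j≢i
  δ-offDiagonal zero    (suc j) j≢i = refl
  δ-offDiagonal (suc i) zero    j≢i = refl
  δ-offDiagonal (suc i) (suc j) j≢i = δ-offDiagonal i j (j≢i ∘ ≡.cong suc)

  δ-sym : ∀ {n} (i j : Fin n) → δ i j ≈ δ j i
  δ-sym zero    zero    = refl
  δ-sym zero    (suc j) = refl
  δ-sym (suc i) zero    = refl
  δ-sym (suc i) (suc j) = δ-sym i j

  sum-zero : ∀ {n} {f : Vector Carrier n} → (∀ i → f i ≈ 0#) → sum f ≈ 0#
  sum-zero {n} f≈0 = trans (sum-cong-≋ f≈0) (sum-replicate-zero n)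

  sum≉0⇒∃ : ∀ {n} (f : Vector Carrier n) → sum f ≉ 0# → ∃[ i ] f i ≉ 0#
  sum≉0⇒∃ f ∑f≉0 with Fin.any? (λ i → ¬? (f i ≟ 0#))
  ... | yes found = found
  ... | no  none  = contradiction
    (sum-zero λ i → decidable-stable (f i ≟ 0#) (λ fi≉0 → none (i , fi≉0))) ∑f≉0

  x*y≈0∧x≉0⇒y≈0 : ∀ {x y} → x * y ≈ 0# → x ≉ 0# → y ≈ 0#
  x*y≈0∧x≉0⇒y≈0 {x} {y} xy≈0 x≉0 with x⁻¹ , xx⁻¹≈1 ← inverse x x≉0 = begin
    y              ≈⟨ *-identityˡ y ⟨
    1# * y         ≈⟨ *-congʳ xx⁻¹≈1 ⟨
    x * x⁻¹ * y    ≈⟨ *-congʳ (*-comm x x⁻¹) ⟩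
    x⁻¹ * x * y    ≈⟨ *-assoc x⁻¹ x y ⟩
    x⁻¹ * (x * y)  ≈⟨ *-congˡ xy≈0 ⟩
    x⁻¹ * 0#       ≈⟨ zeroʳ x⁻¹ ⟩
    0#             ∎

  -- The cancellation behind pivoting, with `b` the inverse of the pivot `a`. It serves both to
  -- clear a coordinate of a vector and to correct a functional.
  x-xb*a≈0 : ∀ {a b} → a * b ≈ 1# → ∀ x → x + - (x * b) * a ≈ 0#
  x-xb*a≈0 {a} {b} ab≈1 x = begin
    x + - (x * b) * a    ≈⟨ +-congˡ (-‿distribˡ-* (x * b) a) ⟨
    x + - (x * b * a)    ≈⟨ +-congˡ (-‿cong (*-assoc x b a)) ⟩
    x + - (x * (b * a))  ≈⟨ +-congˡ (-‿cong (*-congˡ (trans (*-comm b a) ab≈1))) ⟩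
    x + - (x * 1#)       ≈⟨ +-congˡ (-‿cong (*-identityʳ x)) ⟩
    x + - x              ≈⟨ -‿inverseʳ x ⟩
    0#                   ∎

  ·-cong : ∀ {n} {u u′ v v′ : Vector Carrier n} → u ≈ᴹ u′ → v ≈ᴹ v′ → u · v ≈ u′ · v′
  ·-cong u≈u′ v≈v′ = sum-cong-≋ λ i → *-cong (u≈u′ i) (v≈v′ i)

  ·-congˡ : ∀ {n} (u : Vector Carrier n) {v v′} → v ≈ᴹ v′ → u · v ≈ u · v′
  ·-congˡ u = ·-cong {u = u} λ _ → refl

  ·-congʳ : ∀ {n} (v : Vector Carrier n) {u u′} → u ≈ᴹ u′ → u · v ≈ u′ · v
  ·-congʳ v u≈u′ = ·-cong {v = v} u≈u′ λ _ → refl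

  ·-comm : ∀ {n} (u v : Vector Carrier n) → u · v ≈ v · u
  ·-comm u v = sum-cong-≋ λ i → *-comm (u i) (v i)

  ·-zeroʳ : ∀ {n} (u : Vector Carrier n) {v} → v ≈ᴹ 0ᴹ → u · v ≈ 0#
  ·-zeroʳ u v≈0 = sum-zero λ i → trans (*-congˡ (v≈0 i)) (zeroʳ (u i))

  ·-zeroˡ : ∀ {n} {u} (v : Vector Carrier n) → u ≈ᴹ 0ᴹ → u · v ≈ 0#
  ·-zeroˡ v u≈0 = sum-zero λ i → trans (*-congʳ (u≈0 i)) (zeroˡ (v i))

  ·-*ˡ : ∀ {n} α (u v : Vector Carrier n) → (α *ₗ u) · v ≈ α * (u · v)
  ·-*ˡ α u v = trans (sum-cong-≋ λ i → *-assoc α (u i) (v i))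
                     (sym (*-distribˡ-sum α λ i → u i * v i))

  ·-*ʳ : ∀ {n} α (u v : Vector Carrier n) → u · (α *ₗ v) ≈ α * (u · v)
  ·-*ʳ α u v = trans (·-comm u (α *ₗ v)) (trans (·-*ˡ α v u) (*-congˡ (·-comm v u)))

  ·-linearˡ : ∀ {n} (u : Vector Carrier n) α v w → (u +ᴹ α *ₗ v) · w ≈ u · w + α * (v · w)
  ·-linearˡ u α v w = begin
    (u +ᴹ α *ₗ v) · w
      ≈⟨ sum-cong-≋ (λ i → distribʳ (w i) (u i) (α * v i)) ⟩
    sum (λ i → u i * w i + (α *ₗ v) i * w i)
      ≈⟨ ∑-distrib-+ (λ i → u i * w i) (λ i → (α *ₗ v) i * w i) ⟩
    u · w + (α *ₗ v) · w                         ≈⟨ +-congˡ (·-*ˡ α v w) ⟩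
    u · w + α * (v · w)                          ∎

  ·-linearʳ : ∀ {n} (w : Vector Carrier n) u α v → w · (u +ᴹ α *ₗ v) ≈ w · u + α * (w · v)
  ·-linearʳ w u α v = begin
    w · (u +ᴹ α *ₗ v)    ≈⟨ ·-comm w (u +ᴹ α *ₗ v) ⟩
    (u +ᴹ α *ₗ v) · w    ≈⟨ ·-linearˡ u α v w ⟩
    u · w + α * (v · w)  ≈⟨ +-cong (·-comm u w) (*-congˡ (·-comm v w)) ⟩
    w · u + α * (w · v)  ∎

  -- Associativity u(Mv) = (uM)v of row, matrix and column, obtained by exchanging two finite sums.
  ·-assoc : ∀ {m n} (u : Vector Carrier m) (M : Vector (Vector Carrier n) m)
           (v : Vector Carrier n) →
            u · (λ i → M i · v) ≈ (λ j → u · λ i → M i j) · v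
  ·-assoc u M v = begin
    sum (λ i → u i * sum (λ j → M i j * v j))
      ≈⟨ sum-cong-≋ (λ i → *-distribˡ-sum (u i) (λ j → M i j * v j)) ⟩
    sum (λ i → sum (λ j → u i * (M i j * v j)))  ≈⟨ ∑-comm (λ i j → u i * (M i j * v j)) ⟩
    sum (λ j → sum (λ i → u i * (M i j * v j)))
      ≈⟨ sum-cong-≋ (λ j → sum-cong-≋ λ i → *-assoc (u i) (M i j) (v j)) ⟨
    sum (λ j → sum (λ i → u i * M i j * v j))
      ≈⟨ sum-cong-≋ (λ j → *-distribʳ-sum (v j) λ i → u i * M i j) ⟨
    sum (λ j → sum (λ i → u i * M i j) * v j)    ∎

  δ-· : ∀ {n} i (v : Vector Carrier n) → δ i · v ≈ v i
  δ-· zero    v = trans (+-cong (*-identityˡ (v zero)) (·-zeroˡ (v ∘ suc) λ _ → refl))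
                        (+-identityʳ (v zero))
  δ-· (suc i) v = trans (+-cong (zeroˡ (v zero)) (δ-· i (v ∘ suc))) (+-identityˡ (v (suc i)))

  lin-lookup : ∀ {d n} (x : Vector Carrier d) (b : Vector (Vector Carrier n) d) i →
               LA.lin n x b i ≈ x · λ j → b j i
  lin-lookup {zero}  x b i = refl
  lin-lookup {suc d} x b i = +-congˡ (lin-lookup (x ∘ suc) (b ∘ suc) i)

  lin-linear : ∀ {d n} (u : Vector Carrier d) α v (b : Vector (Vector Carrier n) d) →
               LA.lin n (u +ᴹ α *ₗ v) b ≈ᴹ LA.lin n u b +ᴹ α *ₗ LA.lin n v b
  lin-linear u α v b i = begin
    LA.lin _ (u +ᴹ α *ₗ v) b i                      ≈⟨ lin-lookup (u +ᴹ α *ₗ v) b i ⟩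
    (u +ᴹ α *ₗ v) · (λ j → b j i)                   ≈⟨ ·-linearˡ u α v (λ j → b j i) ⟩
    u · (λ j → b j i) + α * (v · λ j → b j i)
      ≈⟨ +-cong (lin-lookup u b i) (*-congˡ (lin-lookup v b i)) ⟨
    LA.lin _ u b i + α * LA.lin _ v b i             ∎

  -- The combination x′ - αx lies in the kernel for `b`, hence in the kernel for `b′`, so the same
  -- scalar α works. This moves proportionality between the two codes.
  lin-Line : ∀ {d m n} {b : Vector (Vector Carrier m) d} {b′ : Vector (Vector Carrier n) d} →
             (∀ x → LA.lin m x b ≈ᴹ 0ᴹ → LA.lin n x b′ ≈ᴹ 0ᴹ) →
             ∀ x x′ → LA.Line m (LA.lin m x b) (LA.lin m x′ b) →
             LA.Line n (LA.lin n x b′) (LA.lin n x′ b′)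
  lin-Line {b = b} {b′} kernel⊆ x x′ (α , x′b≈αxb) = α , λ i →
    x∙y⁻¹≈ε⇒x≈y _ _ (begin
      LA.lin _ x′ b′ i + - (α * LA.lin _ x b′ i)  ≈⟨ +-congˡ (-‿distribˡ-* α _) ⟩
      LA.lin _ x′ b′ i + - α * LA.lin _ x b′ i    ≈⟨ lin-linear x′ (- α) x b′ i ⟨
      LA.lin _ y b′ i                             ≈⟨ kernel⊆ y yb≈0 i ⟩
      0#                                          ∎)
    where
    y = x′ +ᴹ (- α) *ₗ x

    yb≈0 : LA.lin _ y b ≈ᴹ 0ᴹ
    yb≈0 i = begin
      LA.lin _ y b i                              ≈⟨ lin-linear x′ (- α) x b i ⟩
      LA.lin _ x′ b i + - α * LA.lin _ x b i      ≈⟨ +-congˡ (-‿distribˡ-* α _) ⟨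
      LA.lin _ x′ b i + - (α * LA.lin _ x b i)    ≈⟨ x≈y⇒x∙y⁻¹≈ε (x′b≈αxb i) ⟩
      0#                                          ∎

  lin-δ : ∀ {n} (v : Vector Carrier n) → v ≈ᴹ LA.lin n v δ
  lin-δ v l = sym (begin
    LA.lin _ v δ l   ≈⟨ lin-lookup v δ l ⟩
    v · (λ i → δ i l) ≈⟨ ·-congˡ v (λ i → δ-sym i l) ⟩
    v · δ l           ≈⟨ ·-comm v (δ l) ⟩
    δ l · v           ≈⟨ δ-· l v ⟩
    v l               ∎)

  -- Gaussian elimination on the pivot a zero i ≉ 0: subtracting multiples of a zero
  -- clears coordinate i of the other vectors, so a functional z annihilating the
  -- reduced vectors can be corrected at coordinate i to annihilate a zero as well.
  doubleAnnihilator : ∀ {m n} (a : Vector (Vector Carrier n) m) y →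
    (∀ z → (∀ j → z · a j ≈ 0#) → z · y ≈ 0#) → LA.Span n a y
  doubleAnnihilator {zero} a y ⊥⊆ =
    -- Without vectors there is no condition on `z`, so the coordinate functional `δ l` forces `y l`
    -- to vanish.
    Vector.[] , λ l → trans (sym (δ-· l y)) (⊥⊆ (δ l) λ ())
  doubleAnnihilator {suc m} {n} a y ⊥⊆ with Fin.any? (λ i → ¬? (a zero i ≟ 0#))
  -- Without a pivot `a zero` vanishes: it constrains no functional and can take coefficient 0.
  ... | no none = 0# Vector.∷ x , λ l → trans (y≈ l) (sym (trans (+-congʳ (zeroˡ _)) (+-identityˡ _)))
    where
    a₀≈0 : a zero ≈ᴹ 0ᴹ
    a₀≈0 i = decidable-stable (a zero i ≟ 0#) λ a₀i≉0 → none (i , a₀i≉0)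

    rest : LA.Span n (a ∘ suc) y
    rest = doubleAnnihilator (a ∘ suc) y λ z z⊥ →
      ⊥⊆ z λ { zero → ·-zeroʳ z a₀≈0 ; (suc j) → z⊥ j }
    x = proj₁ rest
    y≈ = proj₂ rest
  ... | yes (i , a₀i≉0) with b , a₀ib≈1 ← inverse (a zero i) a₀i≉0 =
    -- `y` is `reduce y` minus `coeff y` times `a zero`, and the reduced vector with index `j`
    -- contains `γ j` times `a zero`; collecting these terms gives the coefficient of the pivot
    -- vector.
    (x · γ + - coeff y) Vector.∷ x , y≈
    where
    a₀ = a zero

    coeff : Vector Carrier n → Carrier
    coeff v = - (v i * b)

    reduce : Vector Carrier n → Vector Carrier n
    reduce v = v +ᴹ coeff v *ₗ a₀

    γ : Vector Carrier m
    γ = coeff ∘ a ∘ suc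

    reduced⊥ : ∀ z → (∀ j → z · reduce (a (suc j)) ≈ 0#) → z · reduce y ≈ 0#
    reduced⊥ z z⊥ = begin
      z · reduce y   ≈⟨ agree y ⟨
      z′ · reduce y  ≈⟨ z′-reduce y ⟩
      z′ · y         ≈⟨ ⊥⊆ z′ (λ { zero → z′⊥a₀ ; (suc j) → z′⊥a j }) ⟩
      0#             ∎
      where
      t = - (z · a₀ * b)
      z′ = z +ᴹ t *ₗ δ i

      z′· : ∀ v → z′ · v ≈ z · v + t * v i
      z′· v = trans (·-linearˡ z t (δ i) v) (+-congˡ (*-congˡ (δ-· i v)))

      z′⊥a₀ : z′ · a₀ ≈ 0#
      z′⊥a₀ = trans (z′· a₀) (x-xb*a≈0 a₀ib≈1 (z · a₀))

      agree : ∀ v → z′ · reduce v ≈ z · reduce v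
      agree v = begin
        z′ · reduce v                ≈⟨ z′· (reduce v) ⟩
        z · reduce v + t * reduce v i ≈⟨ +-congˡ (*-congˡ (x-xb*a≈0 a₀ib≈1 (v i))) ⟩
        z · reduce v + t * 0#        ≈⟨ +-congˡ (zeroʳ t) ⟩
        z · reduce v + 0#            ≈⟨ +-identityʳ _ ⟩
        z · reduce v                 ∎

      z′-reduce : ∀ v → z′ · reduce v ≈ z′ · v
      z′-reduce v = begin
        z′ · reduce v                  ≈⟨ ·-linearʳ z′ v (coeff v) a₀ ⟩
        z′ · v + coeff v * (z′ · a₀)   ≈⟨ +-congˡ (*-congˡ z′⊥a₀) ⟩
        z′ · v + coeff v * 0#          ≈⟨ +-congˡ (zeroʳ (coeff v)) ⟩
        z′ · v + 0#                    ≈⟨ +-identityʳ _ ⟩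
        z′ · v                         ∎

      z′⊥a : ∀ j → z′ · a (suc j) ≈ 0#
      z′⊥a j = trans (sym (z′-reduce (a (suc j)))) (trans (agree (a (suc j))) (z⊥ j))

    rest : LA.Span n (λ j → reduce (a (suc j))) (reduce y)
    rest = doubleAnnihilator (λ j → reduce (a (suc j))) (reduce y) reduced⊥
    x = proj₁ rest

    y≈ : y ≈ᴹ LA.lin n ((x · γ + - coeff y) Vector.∷ x) a
    y≈ l = begin
      y l                                              ≈⟨ +-identityʳ (y l) ⟨
      y l + 0#                                         ≈⟨ +-congˡ (zeroˡ (a₀ l)) ⟨
      y l + 0# * a₀ l
        ≈⟨ +-congˡ (*-congʳ (-‿inverseʳ (coeff y))) ⟨
      y l + (coeff y + - coeff y) * a₀ l
        ≈⟨ +-congˡ (distribʳ (a₀ l) (coeff y) (- coeff y)) ⟩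
      y l + (coeff y * a₀ l + - coeff y * a₀ l)        ≈⟨ +-assoc _ _ _ ⟨
      reduce y l + - coeff y * a₀ l                    ≈⟨ +-congʳ (proj₂ rest l) ⟩
      LA.lin n x (λ j → reduce (a (suc j))) l + - coeff y * a₀ l
        ≈⟨ +-congʳ (lin-lookup x (λ j → reduce (a (suc j))) l) ⟩
      x · (λ j → a (suc j) l + γ j * a₀ l) + - coeff y * a₀ l
        ≈⟨ +-congʳ (·-congˡ x λ j → +-congˡ (*-comm (γ j) (a₀ l))) ⟩
      x · ((λ j → a (suc j) l) +ᴹ a₀ l *ₗ γ) + - coeff y * a₀ l
        ≈⟨ +-congʳ (·-linearʳ x (λ j → a (suc j) l) (a₀ l) γ) ⟩
      x · (λ j → a (suc j) l) + a₀ l * (x · γ) + - coeff y * a₀ l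
        ≈⟨ +-congʳ (+-cong (sym (lin-lookup x (a ∘ suc) l)) (*-comm (a₀ l) (x · γ))) ⟩
      LA.lin n x (a ∘ suc) l + x · γ * a₀ l + - coeff y * a₀ l
        ≈⟨ +-assoc _ _ _ ⟩
      LA.lin n x (a ∘ suc) l + (x · γ * a₀ l + - coeff y * a₀ l)
        ≈⟨ +-comm _ _ ⟩
      x · γ * a₀ l + - coeff y * a₀ l + LA.lin n x (a ∘ suc) l
        ≈⟨ +-congʳ (distribʳ (a₀ l) (x · γ) (- coeff y)) ⟨
      (x · γ + - coeff y) * a₀ l + LA.lin n x (a ∘ suc) l
        ∎

-- Linear Hamming isometries and inclusion of supports.

module Isometry {c ℓ q} (F : FiniteField c ℓ q) {n : ℕ}
                {φ : Vector (FiniteField.Carrier F) n → Vector (FiniteField.Carrier F) n}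
                (φ-isometry : HammingMetric.IsLinearIsometry F φ) where
  open FiniteField F hiding (zero)
  open HammingMetric F
  open DotProduct F
  open RingProperties ring using (-0#≈0#; -‿injective)
  open IsLinearIsometry φ-isometry
  open LeftModuleMorphisms.IsLeftModuleHomomorphism linear public
  open LeftModule (Space n) using (≈ᴹ-trans; +ᴹ-cong)

  φ-lin : ∀ {d} (x : Vector Carrier d) b → φ (LA.lin n x b) ≈ᴹ LA.lin n x (φ ∘ b)
  φ-lin {zero}  x b = 0ᴹ-homo
  φ-lin {suc d} x b = ≈ᴹ-trans (+ᴹ-homo _ _)
    (+ᴹ-cong (*ₗ-homo (x zero) (b zero)) (φ-lin (x ∘ suc) (b ∘ suc)))

  Disjoint : Vector Carrier n → Vector Carrier n → Set ℓ
  Disjoint v w = ∀ i → v i ≈ 0# ⊎ w i ≈ 0#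

  private
    differ? : ∀ (v w : Vector Carrier n) → Decidable (λ i → v i ≉ w i)
    differ? v w i = ¬? (v i ≟ w i)

    differ⊆supp∪supp : ∀ {v w : Vector Carrier n} → (λ i → v i ≉ w i) ⊆ supp v ∪ supp w
    differ⊆supp∪supp {v} {w} {i} vi≉wi with v i ≟ 0# | w i ≟ 0#
    ... | no vi≉0  | _        = inj₁ vi≉0
    ... | yes _    | no wi≉0  = inj₂ wi≉0
    ... | yes vi≈0 | yes wi≈0 = contradiction (trans vi≈0 (sym wi≈0)) vi≉wi

  distance≡0⇒≈ : ∀ (v w : Vector Carrier n) → distance v w ≡ 0 → v ≈ᴹ w
  distance≡0⇒≈ v w d≡0 i = decidable-stable (v i ≟ w i) λ vi≉wi →
    <⇒≢ (count>0 (differ? v w) (∈-allFin⁺ i) vi≉wi) (≡.sym d≡0)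

  ≈⇒distance≡0 : ∀ {v w : Vector Carrier n} → v ≈ᴹ w → distance v w ≡ 0
  ≈⇒distance≡0 {v} {w} v≈w = count≡0 (differ? v w) (λ i vi≉wi → vi≉wi (v≈w i)) (allFin n)

  φ-injective : ∀ {v w} → φ v ≈ᴹ φ w → v ≈ᴹ w
  φ-injective {v} {w} φv≈φw =
    distance≡0⇒≈ v w (≡.trans (≡.sym (isometry v w)) (≈⇒distance≡0 {φ v} {φ w} φv≈φw))

  -- For disjoint supports, `v` and `w` differ exactly on the union of the supports.
  disjoint⇒additive : ∀ v w → Disjoint v w → distance v w ≡ distance v 0ᴹ ℕ.+ distance w 0ᴹ
  disjoint⇒additive v w v∩w = count-⊎ (differ? v 0ᴹ) (differ? w 0ᴹ) (differ? v w)
    (differ⊆supp∪supp {v} {w})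
    (λ {i} vi≉0 vi≈wi → [ vi≉0 , (λ wi≈0 → vi≉0 (trans vi≈wi wi≈0)) ] (v∩w i))
    (λ {i} wi≉0 vi≈wi → [ (λ vi≈0 → wi≉0 (trans (sym vi≈wi) vi≈0)) , wi≉0 ] (v∩w i))
    (λ {i} vi≉0 wi≉0 → [ vi≉0 , wi≉0 ] (v∩w i))
    (allFin n)

  -- A coordinate in both supports would make the distance strictly smaller, by `count-∪-<`.
  additive⇒disjoint : ∀ v w → distance v w ≡ distance v 0ᴹ ℕ.+ distance w 0ᴹ → Disjoint v w
  additive⇒disjoint v w additive i with v i ≟ 0# | w i ≟ 0#
  ... | yes vi≈0 | _        = inj₁ vi≈0
  ... | no _     | yes wi≈0 = inj₂ wi≈0
  ... | no vi≉0  | no wi≉0  = contradiction additive (<⇒≢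
    (count-∪-< (differ? v 0ᴹ) (differ? w 0ᴹ) (differ? v w) (differ⊆supp∪supp {v} {w})
               (∈-allFin⁺ i) vi≉0 wi≉0))

  distance-congʳ : ∀ (u : Vector Carrier n) {v w} → v ≈ᴹ w → distance u v ≡ distance u w
  distance-congʳ u {v} {w} v≈w = ≡.trans
    -- The positions where `w` differs from itself form an empty set; taking it as second part turns
    -- `count-⊎` into equality of counts for equivalent predicates.
    (count-⊎ (differ? u w) (differ? w w) (differ? u v)
      (λ {i} ui≉vi → inj₁ λ ui≈wi → ui≉vi (trans ui≈wi (sym (v≈w i))))
      (λ {i} ui≉wi ui≈vi → ui≉wi (trans ui≈vi (v≈w i)))
      (λ wi≉wi → contradiction refl wi≉wi)
      (λ _ wi≉wi → wi≉wi refl)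
      (allFin n))
    (≡.trans (≡.cong (distance u w ℕ.+_) (≈⇒distance≡0 {w} {w} λ _ → refl)) (ℕ.+-identityʳ _))

  φ-weight : ∀ v → distance (φ v) 0ᴹ ≡ distance v 0ᴹ
  φ-weight v = ≡.trans (distance-congʳ (φ v) (λ i → sym (0ᴹ-homo i))) (isometry v 0ᴹ)

  φ-disjoint⁺ : ∀ {v w} → Disjoint v w → Disjoint (φ v) (φ w)
  φ-disjoint⁺ {v} {w} v∩w = additive⇒disjoint (φ v) (φ w)
    (≡.trans (isometry v w) (≡.trans (disjoint⇒additive v w v∩w)
      (≡.sym (≡.cong₂ ℕ._+_ (φ-weight v) (φ-weight w)))))

  φ-disjoint⁻ : ∀ {v w} → Disjoint (φ v) (φ w) → Disjoint v w
  φ-disjoint⁻ {v} {w} φv∩φw = additive⇒disjoint v w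
    (≡.trans (≡.sym (isometry v w)) (≡.trans (disjoint⇒additive (φ v) (φ w) φv∩φw)
      (≡.cong₂ ℕ._+_ (φ-weight v) (φ-weight w))))

  -- Coordinate `i` is tested by disjointness from `δ i`. If `v i` vanishes, `φ v` is disjoint from
  -- `φ (δ i)`, hence so is `φ v′`; pulling back, `v′ i` vanishes too.
  φ-supp⁻ : ∀ {v′ v} → supp (φ v′) ⊆ supp (φ v) → supp v′ ⊆ supp v
  φ-supp⁻ {v′} {v} φv′⊆φv {i} v′i≉0 vi≈0 =
    [ v′i≉0 , (λ δii≈0 → 1≉0 (trans (sym (δ-diagonal i)) δii≈0)) ] (v′∩δi i)
    where
    v∩δi : Disjoint v (δ i)
    v∩δi j with j Fin.≟ i
    ... | yes ≡.refl = inj₁ vi≈0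
    ... | no j≢i     = inj₂ (δ-offDiagonal i j j≢i)

    φv′∩φδi : Disjoint (φ v′) (φ (δ i))
    φv′∩φδi j = Sum.map₁
      (λ φvj≈0 → decidable-stable (φ v′ j ≟ 0#) λ φv′j≉0 → φv′⊆φv φv′j≉0 φvj≈0)
      (φ-disjoint⁺ {v} {δ i} v∩δi j)

    v′∩δi : Disjoint v′ (δ i)
    v′∩δi = φ-disjoint⁻ {v′} {δ i} φv′∩φδi

  -- Some φ (δ i) with v′ i ≉ 0# is nonzero at a given j ∈ supp (φ v′). Removing the δ i
  -- component from v leaves a vector disjoint from δ i, whose image thus vanishes at j.
  φ-supp⁺ : ∀ {v′ v} → supp v′ ⊆ supp v → supp (φ v′) ⊆ supp (φ v)
  φ-supp⁺ {v′} {v} v′⊆v {j} φv′j≉0 φvj≈0 = v′⊆v v′i≉0 vi≈0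
    where
    expand : φ v′ j ≈ v′ · λ i → φ (δ i) j
    expand = trans (⟦⟧-cong (lin-δ v′) j) (trans (φ-lin v′ δ j) (lin-lookup v′ (φ ∘ δ) j))

    nonzeroTerm : ∃[ i ] v′ i * φ (δ i) j ≉ 0#
    nonzeroTerm = sum≉0⇒∃ (λ i → v′ i * φ (δ i) j) λ ∑≈0 → φv′j≉0 (trans expand ∑≈0)
    i = proj₁ nonzeroTerm

    v′i≉0 : v′ i ≉ 0#
    v′i≉0 v′i≈0 = proj₂ nonzeroTerm (trans (*-congʳ v′i≈0) (zeroˡ _))

    φδij≉0 : φ (δ i) j ≉ 0#
    φδij≉0 φδij≈0 = proj₂ nonzeroTerm (trans (*-congˡ φδij≈0) (zeroʳ _))

    u : Vector Carrier n
    u = v +ᴹ (- v i) *ₗ δ i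

    u∩δi : Disjoint u (δ i)
    u∩δi l with l Fin.≟ i
    ... | no l≢i     = inj₂ (δ-offDiagonal i l l≢i)
    ... | yes ≡.refl = inj₁ (trans (+-congˡ (trans (*-congˡ (δ-diagonal i)) (*-identityʳ (- v i))))
                                   (-‿inverseʳ (v i)))

    φuj≈0 : φ u j ≈ 0#
    φuj≈0 = Sum.fromInj₁ (λ φδij≈0 → contradiction φδij≈0 φδij≉0) (φ-disjoint⁺ {u} {δ i} u∩δi j)

    -vi≈0 : - v i ≈ 0#
    -vi≈0 = x*y≈0∧x≉0⇒y≈0 (begin
      φ (δ i) j * - v i              ≈⟨ *-comm _ _ ⟩
      - v i * φ (δ i) j              ≈⟨ +-identityˡ _ ⟨
      0# + - v i * φ (δ i) j         ≈⟨ +-congʳ φvj≈0 ⟨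
      φ v j + - v i * φ (δ i) j      ≈⟨ +-congˡ (*ₗ-homo (- v i) (δ i) j) ⟨
      φ v j + φ ((- v i) *ₗ δ i) j   ≈⟨ +ᴹ-homo v _ j ⟨
      φ u j                          ≈⟨ φuj≈0 ⟩
      0#                             ∎) φδij≉0
      where open SetoidReasoning setoid

    vi≈0 : v i ≈ 0#
    vi≈0 = -‿injective (trans -vi≈0 (sym -0#≈0#))

-- Rank supports and annihilators over the subfield `K`.

module Duality
  {cK ℓK cL ℓL q m} (K : FiniteField cK ℓK q) (L : FiniteField cL ℓL (q ^ m))
  (ι : FiniteField.Carrier K → FiniteField.Carrier L)
  (ι-hom : RingMorphisms.IsRingHomomorphism (FiniteField.rawRing K) (FiniteField.rawRing L) ι)
  where

  private
    module K = FiniteField K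
    module L = FiniteField L
    module K· = DotProduct K
    module L· = DotProduct L
    open RingMorphisms.IsRingHomomorphism ι-hom
  open RankMetric {q = q} {m = m} K L ι ι-hom
  open HammingMetric L using (supp; Line?)
  open SetoidReasoning L.setoid

  infixl 7 _⊙_
  _⊙_ : ∀ {n} → Vector K.Carrier n → Vector L.Carrier n → L.Carrier
  z ⊙ v = (ι ∘ z) L·.· v

  ι-· : ∀ {n} (u v : Vector K.Carrier n) → ι (u K·.· v) L.≈ u ⊙ (ι ∘ v)
  ι-· {zero}  u v = 0#-homo
  ι-· {suc n} u v = L.trans (+-homo _ _) (L.+-cong (*-homo (u zero) (v zero)) (ι-· (u ∘ suc) (v ∘ suc)))

  ⊙-δ : ∀ {n} i (v : Vector L.Carrier n) → K·.δ i ⊙ v L.≈ v i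
  ⊙-δ i v = L.trans (L·.·-congʳ v (ι-δ i)) (L·.δ-· i v)
    where
    ι-δ : ∀ {n} (i j : Fin n) → ι (K·.δ i j) L.≈ L·.δ i j
    ι-δ zero    zero    = 1#-homo
    ι-δ zero    (suc j) = 0#-homo
    ι-δ (suc i) zero    = 0#-homo
    ι-δ (suc i) (suc j) = ι-δ i j

  Annihilates : ∀ {n} → Vector L.Carrier n → Pred (Vector K.Carrier n) ℓL
  Annihilates v z = z ⊙ v L.≈ L.0#

  module _ {Γ : Vector L.Carrier m} (Γ-basis : L/K.IsBasis U Γ) {n : ℕ} where
    open L/K.IsBasis Γ-basis

    private
      columns : Vector L.Carrier n → Vector (Vector K.Carrier n) m
      columns v = transpose (coordinates Γ-basis v)

    -- Expanding every `v i` in `Γ` shows that the dot products of `z` with the columns of the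
    -- coordinate matrix are the coordinates of `z ⊙ v`. Independence of `Γ` then turns annihilation
    -- of `v` into orthogonality to all columns.
    ⊙-coordinates : ∀ (v : Vector L.Carrier n) z → z ⊙ v L.≈ (λ j → z K·.· columns v j) ⊙ Γ
    ⊙-coordinates v z = begin
      z ⊙ v
        ≈⟨ L·.·-congˡ (ι ∘ z) (λ i → proj₂ (spanning {v i} _)) ⟩
      z ⊙ (λ i → coordinates Γ-basis v i ⊙ Γ)
        ≈⟨ L·.·-assoc (ι ∘ z) (λ i → ι ∘ coordinates Γ-basis v i) Γ ⟩
      (λ j → z ⊙ (ι ∘ columns v j)) L·.· Γ
        ≈⟨ L·.·-congʳ Γ (λ j → ι-· z (columns v j)) ⟨
      (λ j → z K·.· columns v j) ⊙ Γ                  ∎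

    annihilates⇒⊥columns : ∀ {v z} → Annihilates v z → ∀ j → z K·.· columns v j K.≈ K.0#
    annihilates⇒⊥columns {v} {z} zv≈0 =
      independent (λ j → z K·.· columns v j) (L.trans (L.sym (⊙-coordinates v z)) zv≈0)

    ⊥columns⇒annihilates : ∀ {v z} → (∀ j → z K·.· columns v j K.≈ K.0#) → Annihilates v z
    ⊥columns⇒annihilates {v} {z} z⊥ = L.trans (⊙-coordinates v z)
      (L·.·-zeroˡ Γ λ j → L.trans (⟦⟧-cong (z⊥ j)) 0#-homo)

    annihilates⇒⊥rankSupport : ∀ {v z} → Annihilates v z →
                               ∀ {y} → y ∈ rankSupport Γ-basis v → z K·.· y K.≈ K.0#
    annihilates⇒⊥rankSupport {v} {z} zv≈0 {y} (x , y≈) =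
      K.trans (K·.·-congˡ z λ i → K.trans (y≈ i) (K.trans (K·.lin-lookup x (columns v) i)
                                  (K·.·-comm x (coordinates Γ-basis v i))))
      (K.trans (K·.·-assoc z (coordinates Γ-basis v) x)
      (K·.·-zeroˡ x (annihilates⇒⊥columns {v} {z} zv≈0)))

    column∈rankSupport : ∀ v j → columns v j ∈ rankSupport Γ-basis v
    column∈rankSupport v j = K·.δ j , λ i → K.sym
      (K.trans (K·.lin-lookup (K·.δ j) (columns v) i) (K·.δ-· j (coordinates Γ-basis v i)))

    rankSupport⊆⇒annihilates : ∀ {v v′} → rankSupport Γ-basis v′ ⊆ rankSupport Γ-basis v →
                               Annihilates v ⊆ Annihilates v′
    rankSupport⊆⇒annihilates {v} {v′} v′⊆v {z} zv≈0 = ⊥columns⇒annihilates {v′} {z} λ j →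
      annihilates⇒⊥rankSupport {v} {z} zv≈0 (v′⊆v (column∈rankSupport v′ j))

    -- By `doubleAnnihilator` it suffices that each `z` orthogonal to the columns of `v` kills `y`.
    -- Such a `z` annihilates `v`, hence `v′`, hence the rank support of `v′`.
    annihilates⇒rankSupport⊆ : ∀ {v v′} → Annihilates v ⊆ Annihilates v′ →
                               rankSupport Γ-basis v′ ⊆ rankSupport Γ-basis v
    annihilates⇒rankSupport⊆ {v} {v′} v⊆v′ {y} y∈v′ = K·.doubleAnnihilator (columns v) y λ z z⊥ →
      annihilates⇒⊥rankSupport {v′} {z} (v⊆v′ {z} (⊥columns⇒annihilates {v} {z} z⊥)) y∈v′

  -- Columns of the extended matrix and points of the column span.

  module ExtendedMatrix {k n} (G : Vector (Vector L.Carrier n) k)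
                        (E : Vector (Vector L.Carrier (K.#points n)) k)
                        (extended : IsExtendedMatrix G E) where
    open IsExtendedMatrix extended

    private
      N = K.#points n

      column : Fin N → Vector L.Carrier k
      column = transpose E

    open LeftModule (Lⁿ k) using (_≉ᴹ_)
    open L· using (_≈ᴹ_; 0ᴹ; _*ₗ_)

    column? : ∀ w → Decidable (λ j → column j ∈ Lⁿ.Line k w)
    column? w j = Line? w (column j)

    -- Since #points t > 0 iff t > 0, the columns of E represent exactly the points meeting
    -- columnSpan G nontrivially.
    column⇒point : ∀ j → ∃[ u ] u ≉ᴹ 0ᴹ × u ∈ columnSpan G × u ∈ Lⁿ.Line k (column j)
    column⇒point j with multiplicity (column j) (nonzero j)
    ... | zero , _ , μ≡ = contradiction (≡.trans μ≡ (0/n≡0 (q ∸ 1)))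
      (<⇒≢ (count>0 (column? (column j)) (∈-allFin⁺ j) (L.1# , λ i → L.sym (L.*-identityˡ _))) ∘ ≡.sym)
    ... | suc t , (b , basis) , _ = b zero , b₀≉0 , inside zero
      where
      open Lⁿ/K.IsBasis k basis
      b₀≉0 : b zero ≉ᴹ 0ᴹ
      b₀≉0 b₀≈0 = K.1≉0 (independent (K·.δ zero)
        (λ i → L.trans (L·.lin-lookup (ι ∘ K·.δ zero) b i)
                 (L.trans (⊙-δ zero (λ j → b j i)) (b₀≈0 i))) zero)

    point⇒column : ∀ {u} → u ∈ columnSpan G → u ≉ᴹ 0ᴹ → ∃[ j ] column j ∈ Lⁿ.Line k u
    point⇒column {u} u∈U u≉0 with multiplicity u u≉0
    -- The intersection contains `u` itself, so an empty basis would force `u` to be zero.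
    ... | zero , (b , basis) , _ = contradiction
      (proj₂ (Lⁿ/K.IsBasis.spanning basis (u∈U , L.1# , λ i → L.sym (L.*-identityˡ _)))) u≉0
    ... | suc t , _ , μ≡ = count>0⇒∃ (column? u) {xs = allFin N}
      (≡.subst (0 <_) (≡.sym μ≡) (#points>0 q t))

    -- The identity ⟨z , xG⟩ = ⟨x , Gz⟩ is associativity up to commuting factors; the combination on
    -- the right is Gz, a general element of the column span.
    ⊙-lin : ∀ z x → z ⊙ Lⁿ.lin n x G L.≈ x L·.· Lⁿ/K.lin k z (transpose G)
    ⊙-lin z x = begin
      z ⊙ Lⁿ.lin n x G
        ≈⟨ L·.·-congˡ (ι ∘ z) (λ i → L.trans (L·.lin-lookup x G i)
                                              (L·.·-comm x (transpose G i))) ⟩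
      z ⊙ (λ i → transpose G i L·.· x)        ≈⟨ L·.·-assoc (ι ∘ z) (transpose G) x ⟩
      (λ l → z ⊙ G l) L·.· x                  ≈⟨ L·.·-comm _ x ⟩
      x L·.· (λ l → z ⊙ G l)
        ≈⟨ L·.·-congˡ x (L·.lin-lookup (ι ∘ z) (transpose G)) ⟨
      x L·.· Lⁿ/K.lin k z (transpose G)       ∎

    lin-E : ∀ x j → Lⁿ.lin N x E j L.≈ x L·.· column j
    lin-E x = L·.lin-lookup x E

    ·-Line : ∀ {w v} → v ∈ Lⁿ.Line k w → ∀ x → x L·.· w L.≈ L.0# → x L·.· v L.≈ L.0#
    ·-Line {w} {v} (α , v≈αw) x xw≈0 = begin
      x L·.· v           ≈⟨ L·.·-congˡ x v≈αw ⟩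
      x L·.· (α *ₗ w)    ≈⟨ L·.·-*ʳ α x w ⟩
      α L.* (x L·.· w)   ≈⟨ L.*-congˡ xw≈0 ⟩
      α L.* L.0#         ≈⟨ L.zeroʳ α ⟩
      L.0#               ∎

    -- The scalar relating `v` to `w` is nonzero because `v` is, so it can be cancelled.
    ·-Line⁻ : ∀ {w v} → v ≉ᴹ 0ᴹ → v ∈ Lⁿ.Line k w → ∀ x → x L·.· v L.≈ L.0# → x L·.· w L.≈ L.0#
    ·-Line⁻ {w} {v} v≉0 (α , v≈αw) x xv≈0 = L·.x*y≈0∧x≉0⇒y≈0
      (L.trans (L.sym (L·.·-*ʳ α x w)) (L.trans (L.sym (L·.·-congˡ x v≈αw)) xv≈0))
      λ α≈0 → v≉0 λ i → L.trans (v≈αw i) (L.trans (L.*-congʳ α≈0) (L.zeroˡ (w i)))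

    -- A column orthogonal to `x` is exchanged for a nonzero `u` = Gz on its line. Then `z`
    -- annihilates xG, hence x′G, so `x′` is orthogonal to `u` and therefore to the column.
    annihilates⇒supp⊆ : ∀ x x′ → Annihilates (Lⁿ.lin n x G) ⊆ Annihilates (Lⁿ.lin n x′ G) →
                        supp (Lⁿ.lin N x′ E) ⊆ supp (Lⁿ.lin N x E)
    annihilates⇒supp⊆ x x′ ann⊆ {j} x′ej≉0 xej≈0
      with u , u≉0 , (z , u≈) , u∈e ← column⇒point j =
      x′ej≉0 (L.trans (lin-E x′ j) (·-Line⁻ u≉0 u∈e x′ (begin
        x′ L·.· u                              ≈⟨ L·.·-congˡ x′ u≈ ⟩
        x′ L·.· Lⁿ/K.lin k z (transpose G)     ≈⟨ ⊙-lin z x′ ⟨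
        z ⊙ Lⁿ.lin n x′ G                      ≈⟨ ann⊆ {z} zv≈0 ⟩
        L.0#                                   ∎)))
      where
      zv≈0 : Annihilates (Lⁿ.lin n x G) z
      zv≈0 = begin
        z ⊙ Lⁿ.lin n x G                       ≈⟨ ⊙-lin z x ⟩
        x L·.· Lⁿ/K.lin k z (transpose G)      ≈⟨ L·.·-congˡ x u≈ ⟨
        x L·.· u
          ≈⟨ ·-Line u∈e x (L.trans (L.sym (lin-E x j)) xej≈0) ⟩
        L.0#                                   ∎

    supp⊆⇒annihilates : ∀ x x′ → supp (Lⁿ.lin N x′ E) ⊆ supp (Lⁿ.lin N x E) →
                        Annihilates (Lⁿ.lin n x G) ⊆ Annihilates (Lⁿ.lin n x′ G)
    supp⊆⇒annihilates x x′ supp⊆ {z} zv≈0 with Fin.all? (λ i → Lⁿ/K.lin k z (transpose G) i L.≟ L.0#)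
    -- Gz = 0 represents no point and has no column, but its product with `x′` is zero anyway.
    ... | yes u≈0 = L.trans (⊙-lin z x′) (L·.·-zeroʳ x′ u≈0)
    ... | no u≉0 with j , e∈u ← point⇒column (z , λ i → L.refl) u≉0 =
      L.trans (⊙-lin z x′) (·-Line⁻ (nonzero j) e∈u x′ (L.trans (L.sym (lin-E x′ j)) x′ej≈0))
      where
      xej≈0 : Lⁿ.lin N x E j L.≈ L.0#
      xej≈0 = L.trans (lin-E x j) (·-Line e∈u x (L.trans (L.sym (⊙-lin z x)) zv≈0))

      x′ej≈0 : Lⁿ.lin N x′ E j L.≈ L.0#
      x′ej≈0 = decidable-stable (_ L.≟ L.0#) λ x′ej≉0 → supp⊆ {j} x′ej≉0 xej≈0

    -- If xE vanishes, its support lies in that of 0E. Every `z` annihilates 0G, hence xG, and the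
    -- choices `K·.δ i` read off the coordinates of xG.
    lin-kernel : ∀ x → Lⁿ.lin N x E ≈ᴹ 0ᴹ → Lⁿ.lin n x G ≈ᴹ 0ᴹ
    lin-kernel x xE≈0 i = L.trans (L.sym (⊙-δ i (Lⁿ.lin n x G)))
      (supp⊆⇒annihilates (λ _ → L.0#) x (λ {j} xej≉0 → contradiction (xE≈0 j) xej≉0) {K·.δ i}
        (L·.·-zeroʳ (ι ∘ K·.δ i) λ l → L.trans (L·.lin-lookup (λ _ → L.0#) G l)
                                          (L·.·-zeroˡ (λ i → G i l) λ _ → L.refl)))

-- Transfer of minimality through the common coefficient vectors x.

theorem5p13 :
  ∀ {cK ℓK cL ℓL p p′ : Level} (q n m k d : ℕ) →
  PrimePower q → 0 < n → 0 < m → 0 < k →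
  (K : FiniteField cK ℓK q) (L : FiniteField cL ℓL (q ^ m)) →
  let module K = FiniteField K
      module L = FiniteField L
  in
  (ι : K.Carrier → L.Carrier)
  (ι-hom : RingMorphisms.IsRingHomomorphism K.rawRing L.rawRing ι) →
  let open RankMetric {q = q} {m = m} K L ι ι-hom
      open HammingMetric L
  in
  (Γ : Vector L.Carrier m) (Γ-basis : L/K.IsBasis U Γ)
  (C : Pred (Vector L.Carrier n) p) →
  IsRankMetricCode Γ-basis n k d C →
  Nondegenerate Γ-basis C →
  (D : Pred (Vector L.Carrier (K.#points n)) p′) →
  IsAssociatedHammingCode k C D →
  RankMinimal Γ-basis C ⇔ HammingMinimal D
theorem5p13 q n m k d _ _ _ _ K L ι ι-hom Γ Γ-basis C code _ D associated = mk⇔ to from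
  where
  open RankMetric {q = q} {m = m} K L ι ι-hom
  open HammingMetric L using (HammingMinimal; supp)
  open FiniteField L hiding (zero)
  open DotProduct L
  open Duality {q = q} {m = m} K L ι ι-hom
  open IsAssociatedHammingCode associated
  open ExtendedMatrix G E extended
  open Isometry L φ-isometry
  open IsRankMetricCode code using (subspace)
  module G = Lⁿ.IsBasis n generator

  encode : Vector Carrier k → Vector Carrier n
  encode x = Lⁿ.lin n x G

  encodeᴴ : Vector Carrier k → Vector Carrier N
  encodeᴴ x = Lⁿ.lin N x E

  encode∈C : ∀ x → encode x ∈ C
  encode∈C = lin∈ (Lⁿ n) subspace G.inside

  φ-encodeᴴ∈D : ∀ x → φ (encodeᴴ x) ∈ D
  φ-encodeᴴ∈D x = proj₂ image (encodeᴴ x , (x , λ _ → refl) , λ _ → refl)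

  decodeᴴ : ∀ {v} → v ∈ D → ∃[ x ] v ≈ᴹ φ (encodeᴴ x)
  decodeᴴ v∈D with y , (x , y≈xE) , v≈φy ← proj₁ image v∈D =
    x , λ i → trans (v≈φy i) (⟦⟧-cong y≈xE i)

  kernelᴴ⊆ : ∀ x → encode x ≈ᴹ 0ᴹ → encodeᴴ x ≈ᴹ 0ᴹ
  kernelᴴ⊆ x xG≈0 i = trans (lin-lookup x E i) (·-zeroˡ (λ j → E j i) (G.independent x xG≈0))

  to : RankMinimal Γ-basis C → HammingMinimal D
  to minimal v v′ v∈D v′∈D _ v′⊆v =
    let x  , v≈  = decodeᴴ v∈D
        x′ , v′≈ = decodeᴴ v′∈D

        φsupp⊆ : supp (φ (encodeᴴ x′)) ⊆ supp (φ (encodeᴴ x))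
        φsupp⊆ = λ {j} φx′j≉0 φxj≈0 →
          v′⊆v {j} (λ v′j≈0 → φx′j≉0 (trans (sym (v′≈ j)) v′j≈0)) (trans (v≈ j) φxj≈0)

        ann⊆ : Annihilates (encode x) ⊆ Annihilates (encode x′)
        ann⊆ = λ {z} → supp⊆⇒annihilates x x′
          (λ {i} → φ-supp⁻ {encodeᴴ x′} {encodeᴴ x} (λ {j} → φsupp⊆ {j}) {i}) {z}

        line : Lⁿ.Line n (encode x) (encode x′)
        line = minimal (encode x) (encode x′) (encode∈C x) (encode∈C x′)
          (annihilates⇒rankSupport⊆ Γ-basis {n} {encode x} {encode x′} (λ {z} → ann⊆ {z}))

        -- Independence of the rows of `G` gives the kernel inclusion that carries α from xG to xE.
        α , x′E≈αxE = lin-Line {b = G} {E} kernelᴴ⊆ x x′ line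
    in α , λ i → trans (v′≈ i) (trans (⟦⟧-cong x′E≈αxE i)
                   (trans (*ₗ-homo α (encodeᴴ x) i) (*-congˡ (sym (v≈ i)))))

  -- Hamming minimality speaks only of nonzero `v′`, while rank minimality includes zero; a zero
  -- image is therefore settled separately, with scalar 0.
  φ-Line : HammingMinimal D → ∀ x x′ → Annihilates (encode x) ⊆ Annihilates (encode x′) →
           Dec (φ (encodeᴴ x′) ≈ᴹ 0ᴹ) → Lⁿ.Line N (φ (encodeᴴ x)) (φ (encodeᴴ x′))
  φ-Line minimal x x′ ann⊆ (yes φx′≈0) = 0# , λ i → trans (φx′≈0 i) (sym (zeroˡ _))
  φ-Line minimal x x′ ann⊆ (no φx′≉0)  =
    minimal (φ (encodeᴴ x)) (φ (encodeᴴ x′)) (φ-encodeᴴ∈D x) (φ-encodeᴴ∈D x′) φx′≉0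
      (λ {j} → φ-supp⁺ {encodeᴴ x′} {encodeᴴ x}
        (λ {i} → annihilates⇒supp⊆ x x′ (λ {z} → ann⊆ {z}) {i}) {j})

  from : HammingMinimal D → RankMinimal Γ-basis C
  from minimal v v′ v∈C v′∈C v′⊆v =
    let x  , v≈  = G.spanning v∈C
        x′ , v′≈ = G.spanning v′∈C

        ann⊆ : Annihilates (encode x) ⊆ Annihilates (encode x′)
        ann⊆ = λ {z} xz≈0 → trans (sym (·-congˡ (ι ∘ z) v′≈))
          (rankSupport⊆⇒annihilates Γ-basis {n} {v} {v′} v′⊆v {z} (trans (·-congˡ (ι ∘ z) v≈) xz≈0))

        β , φx′≈βφx = φ-Line minimal x x′ (λ {z} → ann⊆ {z}) (Fin.all? λ i → φ (encodeᴴ x′) i ≟ 0#)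

        line : Lⁿ.Line N (encodeᴴ x) (encodeᴴ x′)
        -- By linearity β φ(xE) = φ(β xE), so injectivity pulls the proportionality back from the
        -- images.
        line = β , φ-injective {encodeᴴ x′} {β *ₗ encodeᴴ x} λ i →
          trans (φx′≈βφx i) (sym (*ₗ-homo β (encodeᴴ x) i))

        α , x′G≈αxG = lin-Line {b = E} {G} lin-kernel x x′ line
    in α , λ i → trans (v′≈ i) (trans (x′G≈αxG i) (*-congˡ (sym (v≈ i))))
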